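{- Let $A$ be a finite alphabet, $\varphi(P_1,\ldots,P_\ell)$ an MSO sentence over $A$ with monadic predicate symbols $P_1,\ldots,P_\ell$, and $\mathbf{P}_1,\ldots,\mathbf{P}_\ell\subseteq\mathbb{N}$ uniform monadic predicates such that the language $L_{\varphi,\mathbf{P}_1,\ldots,\mathbf{P}_\ell}\subseteq A^*$ is regular. Then there exist regular uniform monadic predicates $\mathbf{Q}_1,\ldots,\mathbf{Q}_\ell\subseteq\mathbb{N}$ such that $L_{\varphi,\mathbf{P}_1,\ldots,\mathbf{P}_\ell} = L_{\varphi,\mathbf{Q}_1,\ldots,\mathbf{Q}_\ell}$.
   Context: Formulae are interpreted over finite words $u = u_0\cdots u_{n-1}$ with positions $0,\ldots,n-1$. MSO formulae are built from $\mathbf{a}(x)$ ($a\in A$), $x\le y$, $P(x)$, Boolean connectives, and first-order and monadic second-order quantification over positions. A uniform monadic predicate is a set $\mathbf{P}\subseteq\mathbb{N}$; on a word of length $n$, $P(x)$ holds iff $x\in\mathbf{P}$ (i.e. $x \in \mathbf{P}\cap\{0,\ldots,n-1\}$). $L_{\varphi,\mathbf{P}_1,\ldots,\mathbf{P}_\ell} = \{u\in A^*\mid u,\mathbf{P}_1,\ldots,\mathbf{P}_\ell\models\varphi\}$. A uniform predicate $\mathbf{Q}\subseteq\mathbb{N}$ is regular if it is ultimately periodic (equivalently, a Boolean combination of singletons $\{c\}$ and residue classes $\{x\mid x\equiv r\bmod q\}$). -}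

module Defs where

open import Data.Nat using (ℕ; zero; suc; _+_; _≤_)
open import Data.Fin using (Fin; toℕ; zero; suc)
open import Data.Bool using (Bool; true; false)
open import Data.List using (List; []; _∷_; length; lookup; foldl)
open import Data.Product using (Σ; _×_; ∃; _,_)
open import Data.Sum using (_⊎_)
open import Data.Empty using (⊥)
open import Relation.Nullary using (¬_)
open import Relation.Unary using (Pred)
open import Relation.Binary.PropositionalEquality using (_≡_)
open import Level using (0ℓ)

Word : ℕ → Set
Word k = List (Fin k)

UPred : Set₁
UPred = Pred ℕ 0ℓ

-- MSO formulae over alphabet Fin k, with ℓ monadic predicate symbols,
-- m free first-order variables and s free second-order variables
-- (de Bruijn indices).
data Formula (k ℓ : ℕ) : ℕ → ℕ → Set where
  letter : ∀ {m s} → Fin k → Fin m → Formula k ℓ m s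
  leq    : ∀ {m s} → Fin m → Fin m → Formula k ℓ m s
  pred   : ∀ {m s} → Fin ℓ → Fin m → Formula k ℓ m s
  mem    : ∀ {m s} → Fin m → Fin s → Formula k ℓ m s
  neg    : ∀ {m s} → Formula k ℓ m s → Formula k ℓ m s
  and    : ∀ {m s} → Formula k ℓ m s → Formula k ℓ m s → Formula k ℓ m s
  or     : ∀ {m s} → Formula k ℓ m s → Formula k ℓ m s → Formula k ℓ m s
  ex1    : ∀ {m s} → Formula k ℓ (suc m) s → Formula k ℓ m s
  all1   : ∀ {m s} → Formula k ℓ (suc m) s → Formula k ℓ m s
  ex2    : ∀ {m s} → Formula k ℓ m (suc s) → Formula k ℓ m s
  all2   : ∀ {m s} → Formula k ℓ m (suc s) → Formula k ℓ m s

Sentence : ℕ → ℕ → Set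
Sentence k ℓ = Formula k ℓ 0 0

extend : ∀ {A : Set} {m} → A → (Fin m → A) → Fin (suc m) → A
extend a ρ zero    = a
extend a ρ (suc i) = ρ i

Sat : ∀ {k ℓ m s} (u : Word k) (Ps : Fin ℓ → UPred)
      (ρ : Fin m → Fin (length u)) (σ : Fin s → (Fin (length u) → Bool)) →
      Formula k ℓ m s → Set
Sat u Ps ρ σ (letter a x) = lookup u (ρ x) ≡ a
Sat u Ps ρ σ (leq x y)    = toℕ (ρ x) ≤ toℕ (ρ y)
Sat u Ps ρ σ (pred i x)   = Ps i (toℕ (ρ x))
Sat u Ps ρ σ (mem x X)    = σ X (ρ x) ≡ true
Sat u Ps ρ σ (neg φ)      = ¬ Sat u Ps ρ σ φ
Sat u Ps ρ σ (and φ ψ)    = Sat u Ps ρ σ φ × Sat u Ps ρ σ ψ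
Sat u Ps ρ σ (or φ ψ)     = Sat u Ps ρ σ φ ⊎ Sat u Ps ρ σ ψ
Sat u Ps ρ σ (ex1 φ)      = Σ (Fin (length u)) λ p → Sat u Ps (extend p ρ) σ φ
Sat u Ps ρ σ (all1 φ)     = (p : Fin (length u)) → Sat u Ps (extend p ρ) σ φ
Sat u Ps ρ σ (ex2 φ)      = Σ (Fin (length u) → Bool) λ X → Sat u Ps ρ (extend X σ) φ
Sat u Ps ρ σ (all2 φ)     = (X : Fin (length u) → Bool) → Sat u Ps ρ (extend X σ) φ

noVar : ∀ {A : Set} → Fin 0 → A
noVar ()

Lang : ∀ {k ℓ} → Sentence k ℓ → (Fin ℓ → UPred) → Pred (Word k) 0ℓ
Lang φ Ps u = Sat u Ps noVar noVar φ

record DFA (k : ℕ) : Set where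
  field
    states : ℕ
    init   : Fin states
    δ      : Fin states → Fin k → Fin states
    final  : Fin states → Bool

accepts : ∀ {k} → DFA k → Word k → Bool
accepts M u = DFA.final M (foldl (DFA.δ M) (DFA.init M) u)

Regular : ∀ {k} → Pred (Word k) 0ℓ → Set
Regular {k} L = Σ (DFA k) λ M → ∀ u → (L u → accepts M u ≡ true) × (accepts M u ≡ true → L u)

-- A uniform predicate Q ⊆ ℕ is regular iff ultimately periodic.
UltPeriodic : UPred → Set
UltPeriodic Q = Σ ℕ λ N → Σ ℕ λ p →
  (1 ≤ p) × (∀ x → N ≤ x → (Q x → Q (x + p)) × (Q (x + p) → Q x))

SameLang : ∀ {k} → Pred (Word k) 0ℓ → Pred (Word k) 0ℓ → Set
SameLang L L' = ∀ u → (L u → L' u) × (L' u → L u)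

{-# OPTIONS --safe #-}
module Submission where

-- For predicates given by a sequence c of bit vectors, φ is equivalent to an
-- automaton D reading a word together with c.  Hence "every word of length n
-- is treated alike by D and by the given DFA M" is a property of the length-n
-- prefix of c that is itself recognised by an automaton K.  All prefixes of P
-- are accepted by K; as soon as some sequence has its prefixes up to length |K|
-- accepted, the pigeonhole principle folds it into an ultimately periodic
-- sequence all of whose prefixes are accepted.
--
-- The predicates P need not be decidable, but their restriction to finitely
-- many positions is so up to double negation, and the existence of a sequence
-- whose prefixes up to length |K| are accepted is decidable, so the double
-- negation can be removed.

open import Defs
open import Data.Bool using (Bool; true; false; T; not; _∧_; _∨_; _xor_; if_then_else_)
open import Data.Bool.Properties using (T-∧; T-∨; T?; ⇔→≡)
open import Data.Fin using (Fin; zero; suc; toℕ; fromℕ<; combine; remQuot; finToFun; funToFin)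
open import Data.Fin.Properties
  using (_≟_; any?; 2↔Bool; remQuot-combine; finToFun-funToFin; <⇒≢; toℕ<n; toℕ-fromℕ<;
         sequence; pigeonhole)
open import Data.List as List using (List; []; _∷_; length; lookup; foldl)
open import Data.List.Properties using (length-tabulate)
open import Data.Maybe using (Maybe; just; nothing)
open import Data.Nat using (ℕ; zero; suc; _+_; _*_; _∸_; _^_; _≤_; _<_; z≤n; s≤s; s≤s⁻¹)
open import Data.Nat.Properties
  using (_≤?_; _<?_; ≰⇒>; ≤-trans; <-trans; ≤-<-trans; ≤∧≢⇒<; n<1+n; <⇒≤; +-assoc; m∸n+n≡m;
         m+[n∸m]≡n; m<n⇒0<n∸m)
  renaming (_≟_ to _≟ℕ_; <⇒≢ to <⇒≢ℕ)
open import Data.Product using (Σ; ∃; _×_; _,_; proj₁; proj₂)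
open import Data.Product.Function.NonDependent.Propositional using (_×-⇔_)
open import Data.Sum.Function.Propositional using (_⊎-⇔_)
open import Data.Vec as Vec using (Vec; []; _∷_; tabulate)
open import Data.Vec.Properties using (lookup∘tabulate)
open import Effect.Monad using (RawMonad)
open import Function using (_∘_; case_of_; _⇔_; mk⇔; Equivalence; Inverse)
open import Function.Construct.Composition using (_⇔-∘_)
open import Function.Construct.Identity using (⇔-id)
open import Function.Construct.Symmetry using (⇔-sym)
open import Function.Related.TypeIsomorphisms using (¬-cong-⇔)
open import Relation.Nullary using (¬_; Dec; yes; no; does; contradiction)
open import Relation.Nullary.Decidable
  using (_×-dec_; dec-true; dec-false; decidable-stable; ¬¬-excluded-middle)
open import Relation.Nullary.Negation using (¬¬-map; ¬¬-Monad)
open import Relation.Unary using (Decidable)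
open import Relation.Binary.PropositionalEquality
  using (_≡_; refl; sym; trans; cong; subst; _≗_; module ≡-Reasoning)

open Equivalence using (to; from)

-- Logical equivalences between Booleans and propositions

infixr 1 _∘⇔_
_∘⇔_ : {A B C : Set} → B ⇔ C → A ⇔ B → A ⇔ C
g ∘⇔ f = g ⇔-∘ f

T-does : {P : Set} (P? : Dec P) → T (does P?) ⇔ P
T-does (yes p) = mk⇔ (λ _ → p) (λ _ → _)
T-does (no ¬p) = mk⇔ (λ ()) ¬p

T-not : ∀ b → T (not b) ⇔ (¬ T b)
T-not true  = mk⇔ (λ ()) (λ f → f _)
T-not false = mk⇔ (λ _ ()) (λ _ → _)

T-xor : ∀ a b → (¬ T (a xor b)) ⇔ (a ≡ b)
T-xor true  true  = mk⇔ (λ _ → refl) (λ _ ())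
T-xor true  false = mk⇔ (λ f → contradiction _ f) (λ ())
T-xor false true  = mk⇔ (λ f → contradiction _ f) (λ ())
T-xor false false = mk⇔ (λ _ → refl) (λ _ ())

T-≡true : ∀ {b} → T b ⇔ (b ≡ true)
T-≡true {true}  = mk⇔ (λ _ → refl) (λ _ → _)
T-≡true {false} = mk⇔ (λ ()) (λ ())

T-cong : ∀ {a b} → a ≡ b → T a ⇔ T b
T-cong refl = ⇔-id _

∃-cong : {A : Set} {P Q : A → Set} → (∀ a → P a ⇔ Q a) → ∃ P ⇔ ∃ Q
∃-cong f = mk⇔ (λ (a , p) → a , to (f a) p) (λ (a , q) → a , from (f a) q)

∀-cong : {A : Set} {P Q : A → Set} → (∀ a → P a ⇔ Q a) → (∀ a → P a) ⇔ (∀ a → Q a)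
∀-cong f = mk⇔ (λ p a → to (f a) (p a)) (λ q a → from (f a) (q a))

-- Truth of a Boolean is decidable, hence stable under double negation. This lets universal
-- quantifiers be handled constructively as complement, projection, complement.
¬∃-not : {A : Set} (b : A → Bool) → (¬ ∃ λ a → T (not (b a))) ⇔ (∀ a → T (b a))
¬∃-not b = mk⇔
  (λ h a → decidable-stable (T? (b a)) λ ¬ba → h (a , from (T-not (b a)) ¬ba))
  (λ h (a , nb) → to (T-not (b a)) nb (h a))

-- Automata over words given by their letter function

run : {S Γ : Set} → (S → Γ → S) → S → ∀ {n} → (Fin n → Γ) → S
run δ q {zero}  w = q
run δ q {suc n} w = run δ (δ q (w zero)) (w ∘ suc)

run-cong : {S Γ : Set} (δ : S → Γ → S) (q : S) → ∀ {n} {v w : Fin n → Γ} →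
  v ≗ w → run δ q v ≡ run δ q w
run-cong δ q {zero}  v≗w = refl
run-cong δ q {suc n} {v} {w} v≗w rewrite v≗w zero = run-cong δ (δ q (w zero)) (v≗w ∘ suc)

run-snoc : {S Γ : Set} (δ : S → Γ → S) (q : S) (c : ℕ → Γ) → ∀ n →
  run δ q {suc n} (c ∘ toℕ) ≡ δ (run δ q {n} (c ∘ toℕ)) (c n)
run-snoc δ q c zero    = refl
run-snoc δ q c (suc n) = run-snoc δ (δ q (c 0)) (c ∘ suc) n

foldl-run : {S Γ : Set} (δ : S → Γ → S) (q : S) (u : List Γ) →
  foldl δ q u ≡ run δ q (lookup u)
foldl-run δ q []      = refl
foldl-run δ q (a ∷ u) = foldl-run δ (δ q a) u

-- The two runs are indexed by `Fin n` and by `Fin (length (List.tabulate X))`. Letting `f` see the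
-- position only as a natural number makes the induction go through without transport.
run-tabulate : {S A Γ : Set} (δ : S → Γ → S) (q : S) (f : A → ℕ → Γ) → ∀ {n} (X : Fin n → A) →
  run δ q (λ i → f (X i) (toℕ i)) ≡ run δ q (λ i → f (lookup (List.tabulate X) i) (toℕ i))
run-tabulate δ q f {zero}  X = refl
run-tabulate δ q f {suc n} X =
  run-tabulate δ (δ q (f (X zero) 0)) (λ a → f a ∘ suc) (X ∘ suc)

run-map : {S Γ Δ : Set} (δ : S → Δ → S) (h : Γ → Δ) (q : S) → ∀ {n} (w : Fin n → Γ) →
  run (λ q a → δ q (h a)) q w ≡ run δ q (h ∘ w)
run-map δ h q {zero}  w = refl
run-map δ h q {suc n} w = run-map δ h (δ q (h (w zero))) (w ∘ suc)

-- The letter type is arbitrary because letters will carry bit tracks besides their symbol. States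
-- stay a `Fin`, which the subset construction and the pigeonhole principle rely on.
record Automaton (Γ : Set) : Set where
  field
    states : ℕ
    init   : Fin states
    δ      : Fin states → Γ → Fin states
    final  : Fin states → Bool

open Automaton

accepted : {Γ : Set} → Automaton Γ → ∀ {n} → (Fin n → Γ) → Bool
accepted M w = final M (run (δ M) (init M) w)

Accepts : {Γ : Set} → Automaton Γ → ∀ {n} → (Fin n → Γ) → Set
Accepts M w = T (accepted M w)

Accepts-cong : {Γ : Set} (M : Automaton Γ) → ∀ {n} {v w : Fin n → Γ} →
  v ≗ w → Accepts M v ⇔ Accepts M w
Accepts-cong M v≗w = T-cong (cong (final M) (run-cong (δ M) (init M) v≗w))

complement : {Γ : Set} → Automaton Γ → Automaton Γ
complement M = record { states = states M ; init = init M ; δ = δ M ; final = not ∘ final M }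

Accepts-complement : {Γ : Set} (M : Automaton Γ) → ∀ {n} (w : Fin n → Γ) →
  Accepts (complement M) w ⇔ (¬ Accepts M w)
Accepts-complement M w = T-not (accepted M w)

module _ {Γ : Set} (_∙_ : Bool → Bool → Bool) (M N : Automaton Γ) where

  private
    _⟨,⟩_ : Fin (states M) → Fin (states N) → Fin (states M * states N)
    _⟨,⟩_ = combine

    split : Fin (states M * states N) → Fin (states M) × Fin (states N)
    split = remQuot {states M} (states N)

  product : Automaton Γ
  product = record
    { states = states M * states N
    ; init   = init M ⟨,⟩ init N
    ; δ      = λ r a → δ M (proj₁ (split r)) a ⟨,⟩ δ N (proj₂ (split r)) a
    ; final  = λ r → final M (proj₁ (split r)) ∙ final N (proj₂ (split r))
    }

  run-product : ∀ p q {n} (w : Fin n → Γ) →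
    run (δ product) (p ⟨,⟩ q) w ≡ run (δ M) p w ⟨,⟩ run (δ N) q w
  run-product p q {zero}  w = refl
  run-product p q {suc n} w = trans
    (cong (λ (p , q) → run (δ product) (δ M p (w zero) ⟨,⟩ δ N q (w zero)) (w ∘ suc))
          (remQuot-combine p q))
    (run-product _ _ (w ∘ suc))

  accepted-product : ∀ {n} (w : Fin n → Γ) → accepted product w ≡ accepted M w ∙ accepted N w
  accepted-product w = trans
    (cong (final product) (run-product (init M) (init N) w))
    (cong (λ (p , q) → final M p ∙ final N q)
          (remQuot-combine (run (δ M) (init M) w) (run (δ N) (init N) w)))

-- Coding of finite subsets, and exhaustive search

Member : ∀ {n} → Fin n → Fin (2 ^ n) → Set
Member {n} q S = T (Inverse.to 2↔Bool (finToFun {2} {n} S q))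

member? : ∀ {n} (q : Fin n) (S : Fin (2 ^ n)) → Dec (Member q S)
member? q S = T? _

-- An indicator function is packed into one number below `2 ^ n`, so that sets of states can again
-- serve as the states of an `Automaton`.
subset : ∀ {n} {P : Fin n → Set} → Decidable P → Fin (2 ^ n)
subset P? = funToFin (λ q → Inverse.from 2↔Bool (does (P? q)))

Member-subset : ∀ {n} {P : Fin n → Set} (P? : Decidable P) → ∀ q → Member q (subset P?) ⇔ P q
Member-subset P? q
  rewrite finToFun-funToFin (λ q → Inverse.from 2↔Bool (does (P? q))) q
        | Inverse.strictlyInverseˡ 2↔Bool (does (P? q)) = T-does (P? q)

-- The form of finiteness that the subset construction uses: whether some guess leads from one state
-- to another has to be decidable.
Searchable : Set → Set₁
Searchable B = {P : B → Set} → Decidable P → Dec (∃ P)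

Searchable-Bool : Searchable Bool
Searchable-Bool P? with P? true | P? false
... | yes p | _     = yes (true , p)
... | no ¬p | yes q = yes (false , q)
... | no ¬p | no ¬q = no λ { (true , p) → ¬p p ; (false , q) → ¬q q }

Searchable-Vec : {B : Set} → Searchable B → ∀ n → Searchable (Vec B n)
Searchable-Vec search zero P? with P? []
... | yes p = yes ([] , p)
... | no ¬p = no λ { ([] , p) → ¬p p }
Searchable-Vec search (suc n) P? with search (λ b → Searchable-Vec search n (λ v → P? (b ∷ v)))
... | yes (b , v , p) = yes (b ∷ v , p)
... | no ¬p           = no λ { (b ∷ v , p) → ¬p (b , v , p) }

-- The subset construction, guessing a component in B of each letter

module _ {B Σ′ Γ : Set} (search : Searchable B) (g : B → Σ′ → Γ) (M : Automaton Γ) where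

  private
    successor? : ∀ S a q → Dec (∃ λ p → Member p S × ∃ λ b → δ M p (g b a) ≡ q)
    successor? S a q = any? λ p → member? p S ×-dec search λ b → δ M p (g b a) ≟ q

    final? : ∀ S → Dec (∃ λ q → Member q S × T (final M q))
    final? S = any? λ q → member? q S ×-dec T? (final M q)

  projection : Automaton Σ′
  projection = record
    { states = 2 ^ states M
    ; init   = subset (init M ≟_)
    ; δ      = λ S a → subset (successor? S a)
    ; final  = λ S → does (final? S)
    }

  private
    Reach : ∀ {n} → (Fin n → Σ′) → Fin (states M) → Fin (states M) → Set
    Reach {n} w p q = Σ (Fin n → B) λ X → run (δ M) p (λ i → g (X i) (w i)) ≡ q

  -- Induction on the word with `S` arbitrary. Each step of the subset automaton supplies the guess
  -- for one letter, and these guesses are assembled into `X` from the front.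
  Member-run : ∀ {n} (w : Fin n → Σ′) S q →
    Member q (run (δ projection) S w) ⇔ (∃ λ p → Member p S × Reach w p q)
  Member-run {zero} w S q = mk⇔ (λ q∈S → q , q∈S , (λ ()) , refl) λ { (_ , p∈S , _ , refl) → p∈S }
  Member-run {suc n} w S q = mk⇔ there back ∘⇔ Member-run (w ∘ suc) _ q
    where
    there : _ → _
    there (p′ , p′∈ , X , eq) with to (Member-subset (successor? S (w zero)) p′) p′∈
    ... | p , p∈S , b , refl = p , p∈S , extend b X , eq
    back : _ → _
    back (p , p∈S , X , eq) =
      _ , from (Member-subset (successor? S (w zero)) _) (p , p∈S , X zero , refl) , X ∘ suc , eq

  Accepts-projection : ∀ {n} (w : Fin n → Σ′) →
    Accepts projection w ⇔ (Σ (Fin n → B) λ X → Accepts M (λ i → g (X i) (w i)))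
  Accepts-projection w = mk⇔
    (λ acc → case to (T-does (final? _)) acc of λ (q , q∈ , fin) →
      case to (Member-run w _ q) q∈ of λ (p , p∈ , X , eq) →
        case to (Member-subset (init M ≟_) p) p∈ of λ { refl → X , subst (T ∘ final M) (sym eq) fin })
    (λ (X , acc) → from (T-does (final? _))
      (_ , from (Member-run w _ _) (_ , from (Member-subset (init M ≟_) _) refl , X , refl) , acc))

-- Automata for atomic formulae and for first-order variables

module _ {Γ : Set} (f : Γ → Maybe Bool) where

  private
    code : Maybe Bool → Fin 3
    code nothing      = zero
    code (just false) = suc zero
    code (just true)  = suc (suc zero)

    step : Fin 3 → Γ → Fin 3
    step zero    a = code (f a)
    step (suc q) a = suc q

    run-suc : ∀ q {n} (w : Fin n → Γ) → run step (suc q) w ≡ suc q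
    run-suc q {zero}  w = refl
    run-suc q {suc n} w = run-suc q (w ∘ suc)

    verdict : Fin 3 → Bool
    verdict zero          = false
    verdict (suc zero)    = false
    verdict (suc (suc _)) = true

    run-code : ∀ b {n} (w : Fin n → Γ) → verdict (run step (code (just b)) w) ≡ b
    run-code false w = cong verdict (run-suc zero w)
    run-code true  w = cong verdict (run-suc (suc zero) w)

  -- The first letter on which `f` is defined settles the outcome. State 0 means undecided and
  -- rejects; states 1 and 2 are absorbing and record false and true.
  firstVerdict : Automaton Γ
  firstVerdict = record { states = 3 ; init = zero ; δ = step ; final = verdict }

  accepted-firstVerdict : ∀ {n} (w : Fin n → Γ) p b → f (w p) ≡ just b →
    (∀ i → toℕ i < toℕ p → f (w i) ≡ nothing) → accepted firstVerdict w ≡ b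
  accepted-firstVerdict w zero    b eq before rewrite eq = run-code b (w ∘ suc)
  accepted-firstVerdict w (suc p) b eq before rewrite before zero (s≤s z≤n) =
    accepted-firstVerdict (w ∘ suc) p b eq (λ i i<p → before (suc i) (s≤s i<p))

module _ {Γ : Set} (mark : Γ → Bool) where

  private
    -- The state counts the marked letters seen so far, saturating at two.
    step : Fin 3 → Bool → Fin 3
    step q       false = q
    step zero    true  = suc zero
    step (suc _) true  = suc (suc zero)

    once : Fin 3 → Bool
    once (suc zero) = true
    once _          = false

    runMarks : Fin 3 → ∀ {n} → (Fin n → Γ) → Fin 3
    runMarks = run (λ q a → step q (mark a))

    many : ∀ {n} (w : Fin n → Γ) → ¬ T (once (runMarks (suc (suc zero)) w))
    many {suc n} w acc with mark (w zero)
    ... | true  = many (w ∘ suc) acc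
    ... | false = many (w ∘ suc) acc

    none : ∀ {n} (w : Fin n → Γ) →
      T (once (runMarks (suc zero) w)) ⇔ (∀ i → mark (w i) ≡ false)
    none {zero}  w = mk⇔ (λ _ ()) (λ _ → _)
    none {suc n} w with mark (w zero) in eq
    ... | true  = mk⇔ (λ acc → contradiction acc (many (w ∘ suc)))
                      (λ h → contradiction (trans (sym eq) (h zero)) λ ())
    ... | false = mk⇔ (λ { acc zero → eq ; acc (suc i) → to (none (w ∘ suc)) acc i })
                      (λ h → from (none (w ∘ suc)) (h ∘ suc))

    unique : ∀ {n} (w : Fin n → Γ) →
      T (once (runMarks zero w)) ⇔ (∃ λ p → ∀ i → mark (w i) ≡ does (p ≟ i))
    unique {zero}  w = mk⇔ (λ ()) (λ ())
    unique {suc n} w with mark (w zero) in eq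
    ... | true  = mk⇔
      (λ acc → zero , λ { zero → eq ; (suc i) → to (none (w ∘ suc)) acc i })
      (λ { (zero , h) → from (none (w ∘ suc)) (h ∘ suc)
         ; (suc p , h) → contradiction (trans (sym eq) (h zero)) λ () })
    ... | false = mk⇔
      (λ acc → case to (unique (w ∘ suc)) acc of λ (p , h) →
        suc p , λ { zero → eq ; (suc i) → h i })
      (λ { (zero , h) → contradiction (trans (sym eq) (h zero)) λ ()
         ; (suc p , h) → from (unique (w ∘ suc)) (p , h ∘ suc) })

  exactlyOne : Automaton Γ
  exactlyOne = record { states = 3 ; init = zero ; δ = λ q a → step q (mark a) ; final = once }

  Accepts-exactlyOne : ∀ {n} (w : Fin n → Γ) →
    Accepts exactlyOne w ⇔ (∃ λ p → ∀ i → mark (w i) ≡ does (p ≟ i))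
  Accepts-exactlyOne = unique

-- From formulae to automata

-- A first-order variable is carried as the indicator track of its position.
record Letter (k ℓ m s : ℕ) : Set where
  constructor ⟪_,_,_,_⟫
  field
    symbol : Fin k
    preds  : Vec Bool ℓ
    marks  : Vec Bool m
    sets   : Vec Bool s

open Letter

⟦_⟧ : ∀ {ℓ} → (ℕ → Vec Bool ℓ) → Fin ℓ → UPred
⟦ c ⟧ j n = Vec.lookup (c n) j ≡ true

module _ {k ℓ : ℕ} where

  encode : ∀ {m s} (u : Word k) → (ℕ → Vec Bool ℓ) → (Fin m → Fin (length u)) →
    (Fin s → Fin (length u) → Bool) → Fin (length u) → Letter k ℓ m s
  encode u c ρ σ i = ⟪ lookup u i , c (toℕ i)
                     , tabulate (λ x → does (ρ x ≟ i)) , tabulate (λ X → σ X i) ⟫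

  setTrack : ∀ {m s} → Bool → Letter k ℓ m s → Letter k ℓ m (suc s)
  setTrack b ⟪ a , c , f , g ⟫ = ⟪ a , c , f , b ∷ g ⟫

  markTrack : ∀ {m s} → Bool → Letter k ℓ m s → Letter k ℓ (suc m) s
  markTrack b ⟪ a , c , f , g ⟫ = ⟪ a , c , b ∷ f , g ⟫

  existsSet : ∀ {m s} → Automaton (Letter k ℓ m (suc s)) → Automaton (Letter k ℓ m s)
  existsSet = projection Searchable-Bool setTrack

  -- Projection guesses an arbitrary track; `exactlyOne` discards the guesses that are not the
  -- indicator of a single position.
  existsPos : ∀ {m s} → Automaton (Letter k ℓ (suc m) s) → Automaton (Letter k ℓ m s)
  existsPos M = projection Searchable-Bool markTrack
                  (product _∧_ (exactlyOne (Vec.head ∘ marks)) M)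

  Accepts-existsPos : ∀ {m s} (M : Automaton (Letter k ℓ (suc m) s)) {n}
    (w : Fin n → Letter k ℓ m s) →
    Accepts (existsPos M) w ⇔ (∃ λ p → Accepts M (λ i → markTrack (does (p ≟ i)) (w i)))
  Accepts-existsPos M w =
    mk⇔ (λ (X , acc) → case to (unpack X) acc of λ ((p , h) , acc′) →
           p , to (Accepts-cong M (λ i → cong (λ b → markTrack b (w i)) (h i))) acc′)
        (λ (p , acc) → _ , from (unpack (λ i → does (p ≟ i))) ((p , λ i → refl) , acc))
    ∘⇔ Accepts-projection Searchable-Bool markTrack (product _∧_ (exactlyOne (Vec.head ∘ marks)) M) w
    where
    guess : (Fin _ → Bool) → Fin _ → Letter k ℓ _ _
    guess X i = markTrack (X i) (w i)
    single = exactlyOne (Vec.head ∘ marks)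
    unpack : ∀ X → Accepts (product _∧_ single M) (guess X) ⇔
                   ((∃ λ p → ∀ i → X i ≡ does (p ≟ i)) × Accepts M (guess X))
    unpack X = (Accepts-exactlyOne _ (guess X) ×-⇔ ⇔-id _)
               ∘⇔ T-∧ ∘⇔ T-cong (accepted-product _∧_ single M (guess X))

  -- The argument `otherwise` lets tests for several variables be chained on one letter, as the
  -- order relation requires.
  at : ∀ {m s} → Fin m → (Letter k ℓ m s → Bool) → Letter k ℓ m s → Maybe Bool → Maybe Bool
  at x t a otherwise = if Vec.lookup (marks a) x then just (t a) else otherwise

  automaton : ∀ {m s} → Formula k ℓ m s → Automaton (Letter k ℓ m s)
  automaton (letter a x) = firstVerdict λ l → at x (λ l → does (symbol l ≟ a)) l nothing
  -- The mark of `x` is tested first, so equal positions yield true.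
  automaton (leq x y)    = firstVerdict λ l → at x (λ _ → true) l (at y (λ _ → false) l nothing)
  automaton (pred i x)   = firstVerdict λ l → at x (λ l → Vec.lookup (preds l) i) l nothing
  automaton (mem x X)    = firstVerdict λ l → at x (λ l → Vec.lookup (sets l) X) l nothing
  automaton (neg φ)      = complement (automaton φ)
  automaton (and φ ψ)    = product _∧_ (automaton φ) (automaton ψ)
  automaton (or φ ψ)     = product _∨_ (automaton φ) (automaton ψ)
  automaton (ex1 φ)      = existsPos (automaton φ)
  automaton (all1 φ)     = complement (existsPos (complement (automaton φ)))
  automaton (ex2 φ)      = existsSet (automaton φ)
  automaton (all2 φ)     = complement (existsSet (complement (automaton φ)))

  module _ {m s} (u : Word k) (c : ℕ → Vec Bool ℓ)
           (ρ : Fin m → Fin (length u)) (σ : Fin s → Fin (length u) → Bool) where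

    at-here : ∀ x t r → at x t (encode u c ρ σ (ρ x)) r ≡ just (t (encode u c ρ σ (ρ x)))
    at-here x t r rewrite lookup∘tabulate (λ y → does (ρ y ≟ ρ x)) x
                        | dec-true (ρ x ≟ ρ x) refl = refl

    at-before : ∀ x t r i → toℕ i < toℕ (ρ x) → at x t (encode u c ρ σ i) r ≡ r
    at-before x t r i i<ρx rewrite lookup∘tabulate (λ y → does (ρ y ≟ i)) x
                                 | dec-false (ρ x ≟ i) (λ eq → <⇒≢ i<ρx (sym eq)) = refl

    Accepts-at : ∀ x t → Accepts (firstVerdict λ l → at x t l nothing) (encode u c ρ σ) ⇔
      T (t (encode u c ρ σ (ρ x)))
    Accepts-at x t = T-cong (accepted-firstVerdict _ (encode u c ρ σ) (ρ x) _
      (at-here x t nothing) (at-before x t nothing))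

    -- The verdict falls at the earlier of the two marks: at `ρ x` if `x≤y`, and at `ρ y` otherwise.
    Accepts-leq : ∀ x y → Dec (toℕ (ρ x) ≤ toℕ (ρ y)) →
      Accepts (automaton (leq x y)) (encode u c ρ σ) ⇔ (toℕ (ρ x) ≤ toℕ (ρ y))
    Accepts-leq x y (yes x≤y) = mk⇔ (λ _ → x≤y) λ _ → from T-≡true
      (accepted-firstVerdict _ (encode u c ρ σ) (ρ x) true (at-here x _ _) λ i i<x →
        trans (at-before x _ _ i i<x) (at-before y _ _ i (≤-trans i<x x≤y)))
    Accepts-leq x y (no x≰y) = mk⇔ (λ acc → contradiction acc (subst T rejected))
                                       (λ x≤y → contradiction x≤y x≰y)
      where
      y<x = ≰⇒> x≰y
      rejected = accepted-firstVerdict _ (encode u c ρ σ) (ρ y) false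
        (trans (at-before x _ _ (ρ y) y<x) (at-here y _ _)) λ i i<y →
        trans (at-before x _ _ i (<-trans i<y y<x)) (at-before y _ _ i i<y)

  -- Induction on the formula. In the quantifier cases, encoding an extended assignment is
  -- definitionally the old encoding with one more track, which is what projection guesses.
  Accepts-automaton : ∀ {m s} (φ : Formula k ℓ m s) u c ρ σ →
    Accepts (automaton φ) (encode u c ρ σ) ⇔ Sat u ⟦ c ⟧ ρ σ φ
  Accepts-automaton (letter a x) u c ρ σ = T-does (lookup u (ρ x) ≟ a) ∘⇔ Accepts-at u c ρ σ x _
  Accepts-automaton (leq x y) u c ρ σ = Accepts-leq u c ρ σ x y (_ ≤? _)
  Accepts-automaton (pred j x) u c ρ σ = T-≡true ∘⇔ Accepts-at u c ρ σ x _
  Accepts-automaton (mem x X) u c ρ σ =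
    T-≡true ∘⇔ T-cong (lookup∘tabulate (λ Y → σ Y (ρ x)) X) ∘⇔ Accepts-at u c ρ σ x _
  Accepts-automaton (neg φ) u c ρ σ =
    ¬-cong-⇔ (Accepts-automaton φ u c ρ σ) ∘⇔ Accepts-complement (automaton φ) (encode u c ρ σ)
  Accepts-automaton (and φ ψ) u c ρ σ =
    (Accepts-automaton φ u c ρ σ ×-⇔ Accepts-automaton ψ u c ρ σ)
    ∘⇔ T-∧ ∘⇔ T-cong (accepted-product _∧_ (automaton φ) (automaton ψ) (encode u c ρ σ))
  Accepts-automaton (or φ ψ) u c ρ σ =
    (Accepts-automaton φ u c ρ σ ⊎-⇔ Accepts-automaton ψ u c ρ σ)
    ∘⇔ T-∨ ∘⇔ T-cong (accepted-product _∨_ (automaton φ) (automaton ψ) (encode u c ρ σ))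
  Accepts-automaton (ex1 φ) u c ρ σ =
    ∃-cong (λ p → Accepts-automaton φ u c (extend p ρ) σ)
    ∘⇔ Accepts-existsPos (automaton φ) (encode u c ρ σ)
  Accepts-automaton (all1 φ) u c ρ σ =
    ∀-cong (λ p → Accepts-automaton φ u c (extend p ρ) σ)
    ∘⇔ ¬∃-not (λ p → accepted (automaton φ) (encode u c (extend p ρ) σ))
    ∘⇔ ¬-cong-⇔ (Accepts-existsPos (complement (automaton φ)) (encode u c ρ σ))
    ∘⇔ Accepts-complement (existsPos (complement (automaton φ))) (encode u c ρ σ)
  Accepts-automaton (ex2 φ) u c ρ σ =
    ∃-cong (λ X → Accepts-automaton φ u c ρ (extend X σ))
    ∘⇔ Accepts-projection Searchable-Bool setTrack (automaton φ) (encode u c ρ σ)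
  Accepts-automaton (all2 φ) u c ρ σ =
    ∀-cong (λ X → Accepts-automaton φ u c ρ (extend X σ))
    ∘⇔ ¬∃-not (λ X → accepted (automaton φ) (encode u c ρ (extend X σ)))
    ∘⇔ ¬-cong-⇔ (Accepts-projection Searchable-Bool setTrack (complement (automaton φ))
                   (encode u c ρ σ))
    ∘⇔ Accepts-complement (existsSet (complement (automaton φ))) (encode u c ρ σ)

-- Satisfaction depends only on predicate values inside the word

Sat-cong : ∀ {k ℓ m s} (φ : Formula k ℓ m s) u {Ps Qs : Fin ℓ → UPred} →
  (∀ j (i : Fin (length u)) → Ps j (toℕ i) ⇔ Qs j (toℕ i)) →
  ∀ ρ σ → Sat u Ps ρ σ φ ⇔ Sat u Qs ρ σ φ
Sat-cong (letter a x) u P⇔Q ρ σ = ⇔-id _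
Sat-cong (leq x y)    u P⇔Q ρ σ = ⇔-id _
-- Variables denote positions of `u`, so agreement below `length u` suffices.
Sat-cong (pred j x)   u P⇔Q ρ σ = P⇔Q j (ρ x)
Sat-cong (mem x X)    u P⇔Q ρ σ = ⇔-id _
Sat-cong (neg φ)      u P⇔Q ρ σ = ¬-cong-⇔ (Sat-cong φ u P⇔Q ρ σ)
Sat-cong (and φ ψ)    u P⇔Q ρ σ = Sat-cong φ u P⇔Q ρ σ ×-⇔ Sat-cong ψ u P⇔Q ρ σ
Sat-cong (or φ ψ)     u P⇔Q ρ σ = Sat-cong φ u P⇔Q ρ σ ⊎-⇔ Sat-cong ψ u P⇔Q ρ σ
Sat-cong (ex1 φ)      u P⇔Q ρ σ = ∃-cong λ p → Sat-cong φ u P⇔Q (extend p ρ) σ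
Sat-cong (all1 φ)     u P⇔Q ρ σ = ∀-cong λ p → Sat-cong φ u P⇔Q (extend p ρ) σ
Sat-cong (ex2 φ)      u P⇔Q ρ σ = ∃-cong λ X → Sat-cong φ u P⇔Q ρ (extend X σ)
Sat-cong (all2 φ)     u P⇔Q ρ σ = ∀-cong λ X → Sat-cong φ u P⇔Q ρ (extend X σ)

-- Each instance of excluded middle holds up to double negation, and double negation commutes with
-- quantification over a `Fin`. Here there are only `N` times `ℓ` instances.
¬¬-decidable-below : ∀ {ℓ} (Ps : Fin ℓ → UPred) N →
  ¬ ¬ (Σ (ℕ → Vec Bool ℓ) λ c → ∀ j n → n < N → Ps j n ⇔ ⟦ c ⟧ j n)
¬¬-decidable-below {ℓ} Ps N = ¬¬-map approximate
  (sequence ¬¬-applicative λ (i : Fin N) → sequence ¬¬-applicative λ j → ¬¬-excluded-middle)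
  where
  ¬¬-applicative = RawMonad.rawApplicative ¬¬-Monad

  approximate : (∀ (i : Fin N) j → Dec (Ps j (toℕ i))) → _
  approximate P? = (λ n → tabulate (bit n)) , correct
    where
    bit : ℕ → Fin ℓ → Bool
    bit n j with n <? N
    ... | yes n<N = does (P? (fromℕ< n<N) j)
    -- An arbitrary value: `correct` concerns only positions below `N`.
    ... | no  _   = false

    correct : ∀ j n → n < N → Ps j n ⇔ (Vec.lookup (tabulate (bit n)) j ≡ true)
    correct j n n<N rewrite lookup∘tabulate (bit n) j with n <? N
    ... | no n≮N = contradiction n<N n≮N
    ... | yes p  =
      T-≡true ∘⇔ ⇔-sym (T-does (P? (fromℕ< p) j))
      ∘⇔ mk⇔ (subst (Ps j) (sym (toℕ-fromℕ< p))) (subst (Ps j) (toℕ-fromℕ< p))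

-- Ultimately periodic sequences of safe prefixes

module _ {Γ : Set} (search : Searchable Γ) (a₀ : Γ) (K : Automaton Γ) where

  private
    SafeUpTo : ℕ → Fin (states K) → (ℕ → Γ) → Set
    SafeUpTo N q c = ∀ n → n ≤ N → T (final K (run (δ K) q {n} (c ∘ toℕ)))

  -- The start state `q` varies so that the recursion can search for the first letter `a` and
  -- continue from `δ K q a` with a bound smaller by one.
  safe? : ∀ N q → Dec (∃ (SafeUpTo N q))
  safe? N q with T? (final K q)
  safe? N       q | no ¬fin = no λ (c , safe) → ¬fin (safe 0 z≤n)
  -- Only the empty prefix is still to be checked; `a₀` merely pads the sequence.
  safe? zero    q | yes fin = yes ((λ _ → a₀) , λ { zero z≤n → fin })
  safe? (suc N) q | yes fin with search (λ a → safe? N (δ K q a))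
  ... | no ¬safe = no λ (c , safe) → ¬safe (c 0 , c ∘ suc , λ n n≤N → safe (suc n) (s≤s n≤N))
  ... | yes (a , c , safe) = yes (c′ , λ { zero _ → fin ; (suc n) (s≤s n≤N) → safe n n≤N })
    where
    c′ : ℕ → Γ
    c′ zero    = a
    c′ (suc n) = c n

  safeSequence? : ∀ N → Dec (∃ λ c → ∀ n → n ≤ N → Accepts K {n} (c ∘ toℕ))
  safeSequence? N = safe? N (init K)

EventuallyPeriodic : {Γ : Set} → (ℕ → Γ) → Set
EventuallyPeriodic d = ∃ λ N → ∃ λ p → 1 ≤ p × (∀ x → N ≤ x → d x ≡ d (x + p))

module Cycle (i j : ℕ) (i<j : i < j) where

  -- A walk on the positions below `j` in which the last one, `j - 1`, returns to `i`. Thus `pos`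
  -- lists these positions once and then repeats those from `i` on for ever.
  next : ℕ → ℕ
  next t with suc t ≟ℕ j
  ... | yes _ = i
  ... | no  _ = suc t

  pos : ℕ → ℕ
  pos zero    = zero
  pos (suc n) = next (pos n)

  next-last : ∀ t → suc t ≡ j → next t ≡ i
  next-last t eq with suc t ≟ℕ j
  ... | yes _  = refl
  ... | no neq = contradiction eq neq

  next-inner : ∀ t → suc t < j → next t ≡ suc t
  next-inner t lt with suc t ≟ℕ j
  ... | yes eq = contradiction eq (<⇒≢ℕ lt)
  ... | no _   = refl

  pos<j : ∀ n → pos n < j
  pos<j zero    = ≤-<-trans z≤n i<j
  pos<j (suc n) with suc (pos n) ≟ℕ j
  ... | yes _  = i<j
  ... | no neq = ≤∧≢⇒< (pos<j n) neq

  pos-early : ∀ n → n < j → pos n ≡ n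
  pos-early zero    _  = refl
  pos-early (suc n) lt = trans (cong next (pos-early n (<-trans (n<1+n n) lt))) (next-inner n lt)

  pos-wrap : ∀ n → n ≡ j → pos n ≡ i
  pos-wrap zero    refl = contradiction i<j λ ()
  pos-wrap (suc n) refl = trans (cong next (pos-early n (n<1+n n))) (next-last n refl)

  -- At times `i` and `j` the walk is at the same place `i`, and from then on both continuations
  -- iterate the same `next`.
  pos-periodic : ∀ x → pos (x + i) ≡ pos (x + j)
  pos-periodic zero    = trans (pos-early i i<j) (sym (pos-wrap j refl))
  pos-periodic (suc x) = cong next (pos-periodic x)

  periodic : {Γ : Set} (c : ℕ → Γ) → EventuallyPeriodic (c ∘ pos)
  periodic c = i , j ∸ i , m<n⇒0<n∸m i<j , λ x i≤x → cong c (shift x i≤x)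
    where
    open ≡-Reasoning
    shift : ∀ x → i ≤ x → pos x ≡ pos (x + (j ∸ i))
    shift x i≤x = begin
      pos x                     ≡⟨ cong pos (m∸n+n≡m i≤x) ⟨
      pos (x ∸ i + i)           ≡⟨ pos-periodic (x ∸ i) ⟩
      pos (x ∸ i + j)           ≡⟨ cong (λ y → pos (x ∸ i + y)) (m+[n∸m]≡n (<⇒≤ i<j)) ⟨
      pos (x ∸ i + (i + (j ∸ i))) ≡⟨ cong pos (+-assoc (x ∸ i) i (j ∸ i)) ⟨
      pos (x ∸ i + i + (j ∸ i)) ≡⟨ cong (λ y → pos (y + (j ∸ i))) (m∸n+n≡m i≤x) ⟩
      pos (x + (j ∸ i))         ∎

lasso : {Γ : Set} (K : Automaton Γ) (c : ℕ → Γ) →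
  (∀ n → n ≤ states K → Accepts K {n} (c ∘ toℕ)) →
  ∃ λ d → EventuallyPeriodic d × (∀ n → Accepts K {n} (d ∘ toℕ))
-- The prefix lengths 0 to `states K` are one more than the states, so two of them reach the same
-- state.
lasso {Γ} K c safe with pigeonhole (n<1+n (states K)) (λ t → run (δ K) (init K) {toℕ t} (c ∘ toℕ))
... | i , j , i<j , eq = c ∘ pos , periodic c , λ n →
    from (T-cong (cong (final K) (follow n)))
         -- `pos n < j` and `j ≤ states K`, so the walk stays where `c` is known to be safe.
         (safe (pos n) (≤-trans (<⇒≤ (pos<j n)) (s≤s⁻¹ (toℕ<n j))))
  where
  open Cycle (toℕ i) (toℕ j) i<j

  state : (ℕ → Γ) → ℕ → Fin (states K)
  state c n = run (δ K) (init K) {n} (c ∘ toℕ)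

  -- Jumping from `j` back to `i` is invisible to `K`, since `c` leads to the same state at both
  -- lengths.
  state-next : ∀ t → state c (suc t) ≡ state c (next t)
  state-next t with suc t ≟ℕ toℕ j
  ... | yes last = trans (cong (state c) last) (sym eq)
  ... | no  _    = refl

  -- Every prefix of the folded sequence ends in the state that some short prefix of `c` reaches, so
  -- acceptance carries over to all lengths.
  follow : ∀ n → state (c ∘ pos) n ≡ state c (pos n)
  follow zero    = refl
  follow (suc n) = begin
    state (c ∘ pos) (suc n)                   ≡⟨ run-snoc (δ K) (init K) (c ∘ pos) n ⟩
    δ K (state (c ∘ pos) n) (c (pos n))       ≡⟨ cong (λ q → δ K q (c (pos n))) (follow n) ⟩
    δ K (state c (pos n)) (c (pos n))         ≡⟨ run-snoc (δ K) (init K) c (pos n) ⟨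
    state c (suc (pos n))                     ≡⟨ state-next (pos n) ⟩
    state c (pos (suc n))                     ∎
    where open ≡-Reasoning

-- Comparing a DFA with a formula

module _ {k ℓ : ℕ} (M : DFA k) (φ : Sentence k ℓ) where

  private
    symbolDFA : Automaton (Letter k ℓ 0 0)
    symbolDFA = record
      { states = DFA.states M
      ; init   = DFA.init M
      ; δ      = λ q l → DFA.δ M q (symbol l)
      ; final  = DFA.final M
      }

    annotate : Fin k → Vec Bool ℓ → Letter k ℓ 0 0
    annotate a v = ⟪ a , v , [] , [] ⟫

    difference : Automaton (Letter k ℓ 0 0)
    difference = product _xor_ symbolDFA (automaton φ)

  Agree : Word k → (ℕ → Vec Bool ℓ) → Set
  Agree u c = accepts M u ≡ accepted (automaton φ) (encode u c noVar noVar)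

  -- The projection guesses the symbols of a word on which `M` and `automaton φ` differ; its
  -- complement accepts when no word of that length is such a counterexample.
  agreement : Automaton (Vec Bool ℓ)
  agreement = complement (projection any? annotate difference)

  private
    Disagree : (ℕ → Vec Bool ℓ) → ∀ {n} → (Fin n → Fin k) → Set
    Disagree c X = Accepts difference (λ i → annotate (X i) (c (toℕ i)))

    Agree⇔ : ∀ u c → Agree u c ⇔ (¬ Disagree c (lookup u))
    Agree⇔ u c = ¬-cong-⇔ (⇔-sym (T-cong (accepted-product _xor_ symbolDFA (automaton φ) w)))
      ∘⇔ ⇔-sym (T-xor (accepted symbolDFA w) (accepted (automaton φ) w))
      ∘⇔ mk⇔ (trans (sym same)) (trans same)
      where
      w = encode u c noVar noVar
      same : accepts M u ≡ accepted symbolDFA w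
      same = cong (DFA.final M) (trans (foldl-run (DFA.δ M) (DFA.init M) u)
                                       (sym (run-map (DFA.δ M) symbol (DFA.init M) w)))

  Accepts-agreement : ∀ n (c : ℕ → Vec Bool ℓ) →
    Accepts agreement {n} (c ∘ toℕ) ⇔ (∀ u → length u ≡ n → Agree u c)
  Accepts-agreement n c = mk⇔
    (λ { h u refl → from (Agree⇔ u c) λ dis → h (lookup u , dis) })
    -- A guess is a function on `Fin n`, whereas `Agree` speaks of lists, so the guess is tabulated
    -- and the run carried over by `run-tabulate`.
    (λ h (X , dis) → to (Agree⇔ (List.tabulate X) c) (h (List.tabulate X) (length-tabulate X))
      (to (T-cong (cong (final difference)
             (run-tabulate (δ difference) (init difference) (λ a i → annotate a (c i)) X))) dis))
    ∘⇔ ¬-cong-⇔ (Accepts-projection any? annotate difference (c ∘ toℕ))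
    ∘⇔ Accepts-complement (projection any? annotate difference) {n} (c ∘ toℕ)

-- Replacing the predicates by ultimately periodic ones

mainTheorem6 : (k ℓ : ℕ) (φ : Sentence k ℓ) (Ps : Fin ℓ → UPred) →
    Regular (Lang φ Ps) →
    Σ (Fin ℓ → UPred) λ Qs →
    ((i : Fin ℓ) → UltPeriodic (Qs i)) × SameLang (Lang φ Ps) (Lang φ Qs)
mainTheorem6 k ℓ φ Ps (M , M-recognises) =
  case lasso K (proj₁ safe) (proj₂ safe) of λ (d , (N , p , 1≤p , period) , d-safe) →
    ⟦ d ⟧
    -- The whole sequence of bit vectors is periodic, so all predicates share one threshold and one
    -- period.
    , (λ j → N , p , 1≤p , λ x N≤x →
        subst (λ v → Vec.lookup v j ≡ true) (period x N≤x)
      , subst (λ v → Vec.lookup v j ≡ true) (sym (period x N≤x)))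
    , λ u →
        let same = Accepts-automaton φ u d noVar noVar
                   ∘⇔ T-cong (to (Accepts-agreement M φ (length u) d) (d-safe (length u)) u refl)
                   ∘⇔ recognised u
        in to same , from same
  where
  K = agreement M φ

  recognised : ∀ u → Lang φ Ps u ⇔ T (accepts M u)
  recognised u = ⇔-sym T-≡true ∘⇔ mk⇔ (proj₁ (M-recognises u)) (proj₂ (M-recognises u))

  agreeing-safe : ∀ c → (∀ j n → n < states K → Ps j n ⇔ ⟦ c ⟧ j n) →
    ∀ n → n ≤ states K → Accepts K {n} (c ∘ toℕ)
  agreeing-safe c P⇔c n n≤N = from (Accepts-agreement M φ n c) λ { u refl →
    ⇔→≡ (T-≡true ∘⇔ ⇔-sym (Accepts-automaton φ u c noVar noVar)
         -- A word of length `n ≤ states K` has only positions below `states K`, where `c` and `Ps`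
         -- agree.
         ∘⇔ Sat-cong φ u (λ j i → P⇔c j (toℕ i) (≤-trans (toℕ<n i) n≤N)) noVar noVar
         ∘⇔ ⇔-sym (recognised u) ∘⇔ ⇔-sym T-≡true) }

  safe : ∃ λ c → ∀ n → n ≤ states K → Accepts K {n} (c ∘ toℕ)
  safe = decidable-stable
    (safeSequence? (Searchable-Vec Searchable-Bool ℓ) (Vec.replicate ℓ false) K (states K))
    (¬¬-map (λ (c , P⇔c) → c , agreeing-safe c P⇔c) (¬¬-decidable-below Ps (states K)))
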